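{- Let $G$ be a graph on $n$ vertices, let $k$ be an integer with $1\le k\le \frac n2$, and let $F_k=F_k(G)$ be its $k$-token graph. Let $L_1$ and $L_k$ be the Laplacian matrices of $G$ and $F_k$, respectively, and let $B$ be the $(n;k)$-binomial matrix. Then $$B^{\top} L_k B=\binom{n-2}{k-1}L_1 .$$
   Context: All graphs are finite and simple. For a graph $G$ with vertex set $[n]=\{1,\dots,n\}$ and $1\le k\le n$, the $k$-token graph $F_k(G)$ has as vertices the $k$-subsets of $[n]$; two vertices $A,B$ are adjacent iff $A\bigtriangleup B=\{a,b\}$ with $a\in A$, $b\in B$ and $\{a,b\}$ an edge of $G$. The Laplacian matrix of a graph is the diagonal degree matrix minus the adjacency matrix. The $(n;k)$-binomial matrix $B$ is the $\binom nk\times n$ $(0,1)$-matrix whose rows are the characteristic vectors of the $k$-subsets of $[n]$: for a $k$-subset $A$ and $j\in[n]$, $B_{Aj}=1$ if $j\in A$ and $B_{Aj}=0$ otherwise. The rows of $B$ and the rows and columns of $L_k$ are indexed by the $k$-subsets in the same order. -}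

module Defs where

open import Data.Bool.Base using (if_then_else_; _xor_)
open import Data.Bool.Properties using (xor-comm; xor-same)
import Data.Bool.Properties as Bool
open import Data.Fin.Base using (Fin)
open import Data.Fin.Properties using (any?) renaming (_≟_ to _≟ᶠ_)
open import Data.Fin.Subset using (Subset; _∈_; _∪_; ⁅_⁆; ∣_∣; ⊥)
open import Data.Fin.Subset.Properties using (_∈?_; ∪-comm; x∈⁅x⁆; x∈p∪q⁺; ∉⊥)
open import Data.Integer.Base using (ℤ; +_; _-_; _*_; 0ℤ; 1ℤ)
open import Data.Integer.Properties using (+-*-semiring)
open import Data.Nat.Base using (ℕ)
open import Data.Nat.Combinatorics using (_C_)
open import Data.Product.Base using (Σ; ∃₂; _×_; _,_; proj₁)
open import Data.Sum.Base using (inj₁)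
open import Data.Vec.Base using ([]; _∷_; zipWith; count; allFin)
open import Data.Vec.Properties using (≡-dec; zipWith-comm)
open import Function.Bundles using (_↔_; Inverse)
open import Level using (0ℓ)
open import Relation.Binary.Core using (Rel)
open import Relation.Binary.Definitions using (Symmetric; Irreflexive; Decidable)
open import Relation.Binary.PropositionalEquality
  using (_≡_; refl; sym; trans; cong₂; subst)
open import Relation.Nullary.Decidable using (does; _×-dec_)
open import Algebra.Properties.Semiring.Sum +-*-semiring using (sum)

-- Simple graphs.  Finiteness is supplied separately, by an ordering
-- Fin m ↔ V of the vertices.

record Graph (V : Set) : Set₁ where
  field
    Adj     : Rel V 0ℓ
    symm    : Symmetric Adj
    irrefl  : Irreflexive _≡_ Adj
    adj?    : Decidable Adj

-- Integer matrices.  Without function extensionality, equality of matrices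
-- has to be stated entrywise.

Matrix : ℕ → ℕ → Set
Matrix m n = Fin m → Fin n → ℤ

infix  4 _≈ᴹ_
infixl 7 _*ᴹ_
infixr 7 _·ᴹ_
infixl 6 _-ᴹ_
infix  8 _ᵀ

_≈ᴹ_ : ∀ {m n} → Matrix m n → Matrix m n → Set
M ≈ᴹ N = ∀ i j → M i j ≡ N i j

_ᵀ : ∀ {m n} → Matrix m n → Matrix n m
(M ᵀ) i j = M j i

_*ᴹ_ : ∀ {l m n} → Matrix l m → Matrix m n → Matrix l n
(M *ᴹ N) i j = sum (λ r → M i r * N r j)

_-ᴹ_ : ∀ {m n} → Matrix m n → Matrix m n → Matrix m n
(M -ᴹ N) i j = M i j - N i j

_·ᴹ_ : ∀ {m n} → ℤ → Matrix m n → Matrix m n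
(c ·ᴹ M) i j = c * M i j

module _ {V : Set} (G : Graph V) {m : ℕ} (order : Fin m ↔ V) where
  open Graph G
  open Inverse order using () renaming (to to vertex)

  degree : V → ℕ
  degree v = count (λ j → adj? v (vertex j)) (allFin m)

  degreeMatrix : Matrix m m
  degreeMatrix i j = if does (i ≟ᶠ j) then + degree (vertex i) else 0ℤ

  adjacencyMatrix : Matrix m m
  adjacencyMatrix i j = if does (adj? (vertex i) (vertex j)) then 1ℤ else 0ℤ

  laplacian : Matrix m m
  laplacian = degreeMatrix -ᴹ adjacencyMatrix

KSubset : ℕ → ℕ → Set
KSubset n k = Σ (Subset n) λ A → ∣ A ∣ ≡ k

infixl 6 _△_

_△_ : ∀ {n} → Subset n → Subset n → Subset n
_△_ = zipWith _xor_

private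
  △-comm : ∀ {n} (A B : Subset n) → A △ B ≡ B △ A
  △-comm = zipWith-comm xor-comm

  △-self : ∀ {n} (A : Subset n) → A △ A ≡ ⊥
  △-self []      = refl
  △-self (x ∷ A) = cong₂ _∷_ (xor-same x) (△-self A)

module _ {n : ℕ} (G : Graph (Fin n)) (k : ℕ) where
  open Graph G

  TokenAdj : Rel (KSubset n k) 0ℓ
  TokenAdj (A , _) (B , _) =
    ∃₂ λ a b → A △ B ≡ ⁅ a ⁆ ∪ ⁅ b ⁆ × a ∈ A × b ∈ B × Adj a b

  tokenGraph : Graph (KSubset n k)
  tokenGraph = record
    { Adj    = TokenAdj
    ; symm   = λ { {A , _} {B , _} (a , b , eq , a∈A , b∈B , ab) →
                   b , a , trans (△-comm B A) (trans eq (∪-comm ⁅ a ⁆ ⁅ b ⁆))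
                     , b∈B , a∈A , symm ab }
    ; irrefl = λ { {A , _} refl (a , b , eq , _) →
                   ∉⊥ (subst (a ∈_) (trans (sym eq) (△-self A))
                             (x∈p∪q⁺ (inj₁ (x∈⁅x⁆ a)))) }
    ; adj?   = λ { (A , _) (B , _) →
                   any? λ a → any? λ b →
                     ≡-dec Bool._≟_ (A △ B) (⁅ a ⁆ ∪ ⁅ b ⁆)
                     ×-dec a ∈? A ×-dec b ∈? B ×-dec adj? a b }
    }

binomialMatrix : ∀ n k → Fin (n C k) ↔ KSubset n k → Matrix (n C k) n
binomialMatrix n k order r j =
  if does (j ∈? proj₁ (Inverse.to order r)) then 1ℤ else 0ℤ

module Submission where

-- A Laplacian acts by (L x)(u) = Σ_{v ~ u} (x u − x v).  The neighbours of a
-- k-subset A in the token graph are obtained by moving one token along an edge,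
-- and such a move changes the indicator of j ∈ A only if the edge contains j.
-- Hence (Lₖ B)(A, l) = Σ_{b ~ l} ([l ∈ A] − [b ∈ A]).  Summing over the A that
-- contain i and counting the k-subsets which contain i but not b (there are
-- C(n−2, k−1) of them if i ≠ b, and none otherwise) turns this into
-- C(n−2, k−1) Σ_{b ~ l} ([i = l] − [i = b]) = C(n−2, k−1) L₁(l, i).

open import Defs
open import Data.Bool.Base using (if_then_else_)
import Data.Bool.Properties as Bool
open import Data.Fin.Base using (Fin; zero; suc)
open import Data.Fin.Properties using (suc-injective) renaming (_≟_ to _≟ᶠ_)
open import Data.Fin.Subset
  using (Subset; inside; outside; _∈_; _∉_; _∪_; ⁅_⁆; ∣_∣; ⊥)
open import Data.Fin.Subset.Properties
  using (_∈?_; ∉⊥; ∣⊥∣≡0; ∪-comm; ∪-identityˡ; ∪-identityʳ; x∈p∪q⁺; x∈p∪q⁻; x∈⁅x⁆; x∈⁅y⁆⇒x≡y)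
open import Data.Integer.Base using (ℤ; +_; 0ℤ; 1ℤ; _+_; _-_) renaming (_*_ to _·_)
import Data.Integer.Properties as ℤ
open import Data.Integer.Tactic.RingSolver using (solve-∀)
open import Data.Nat.Base using (ℕ; zero; suc; _≤_; _*_; _∸_; s≤s)
open import Data.Nat.Combinatorics using (_C_; nCk+nC[k+1]≡[n+1]C[k+1])
import Data.Nat.Properties as ℕ
open import Data.Product.Base using (_,_; proj₁; proj₂)
open import Data.Sum.Base using (inj₁; inj₂)
open import Data.Vec.Base using (Vec; []; _∷_; here; there; count; allFin; lookup)
open import Data.Vec.Properties
  using (≡-dec; ∷-injectiveʳ; lookup-allFin; zipWith-identityʳ)
open import Function.Base using (_∘_)
open import Function.Bundles using (_↔_; _⇔_; mk⇔; Inverse)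
open import Function.Construct.Identity using (↔-id)
open import Relation.Binary.PropositionalEquality
  using (_≡_; _≢_; refl; sym; trans; cong; cong₂; subst; module ≡-Reasoning)
open import Relation.Nullary.Decidable
  using (Dec; yes; no; does; dec-true; dec-false; does-⇔; decidable-stable)
open import Relation.Nullary.Negation using (¬_; contradiction)
open import Relation.Unary using (Pred; Decidable)
open import Algebra.Properties.Semiring.Sum ℤ.+-*-semiring
open import Algebra.Properties.CommutativeSemigroup ℤ.*-commutativeSemigroup using (x∙yz≈y∙xz)

open ≡-Reasoning

private variable
  n k m : ℕ
  P Q : Set

-- Indicators and finite sums

-- Unfolds to the same `if` as the entries of `adjacencyMatrix` and `binomialMatrix`, so those
-- entries are indicators by definition.
⟦_⟧ : Dec P → ℤ
⟦ P? ⟧ = if does P? then 1ℤ else 0ℤ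

⟦⟧-true : (P? : Dec P) → P → ⟦ P? ⟧ ≡ 1ℤ
⟦⟧-true P? p = cong (if_then 1ℤ else 0ℤ) (dec-true P? p)

⟦⟧-false : (P? : Dec P) → ¬ P → ⟦ P? ⟧ ≡ 0ℤ
⟦⟧-false P? ¬p = cong (if_then 1ℤ else 0ℤ) (dec-false P? ¬p)

⟦⟧-cong : P ⇔ Q → (P? : Dec P) (Q? : Dec Q) → ⟦ P? ⟧ ≡ ⟦ Q? ⟧
⟦⟧-cong P⇔Q P? Q? = cong (if_then 1ℤ else 0ℤ) (does-⇔ P⇔Q P? Q?)

sum-zero : {f : Fin m → ℤ} → (∀ i → f i ≡ 0ℤ) → sum f ≡ 0ℤ
sum-zero {m} f≗0 = trans (sum-cong-≗ f≗0) (sum-replicate-zero m)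

-- The shape left in `sum-moveTerm-subsets` when `j` and `b` have equal membership and their
-- difference computes to `0ℤ`; the right side stays `a · 0ℤ` to match.
sum-·0 : (f : Fin m → ℤ) (a : ℤ) → sum (λ i → f i · (a · 0ℤ)) ≡ a · 0ℤ
sum-·0 f a = trans
  (sum-zero λ i → trans (cong (f i ·_) (ℤ.*-zeroʳ a)) (ℤ.*-zeroʳ (f i)))
  (sym (ℤ.*-zeroʳ a))

sum-single : (f : Fin m → ℤ) (i : Fin m) → (∀ j → j ≢ i → f j ≡ 0ℤ) → sum f ≡ f i
sum-single f zero    off = trans (cong (_+_ (f zero)) (sum-zero λ j → off (suc j) λ ()))
                                 (ℤ.+-identityʳ (f zero))
sum-single f (suc i) off = trans
  (cong₂ _+_ (off zero λ ())
             (sum-single (f ∘ suc) i λ j j≢i → off (suc j) (j≢i ∘ suc-injective)))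
  (ℤ.+-identityˡ (f (suc i)))

sum-distrib-- : (f g : Fin m → ℤ) → sum (λ i → f i - g i) ≡ sum f - sum g
sum-distrib-- {zero}  f g = refl
sum-distrib-- {suc m} f g = trans
  (cong (_+_ (f zero - g zero)) (sum-distrib-- (f ∘ suc) (g ∘ suc)))
  (interchange (f zero) (g zero) (sum (f ∘ suc)) (sum (g ∘ suc)))
  where
  interchange : ∀ a b c d → (a - b) + (c - d) ≡ (a + c) - (b + d)
  interchange = solve-∀

count≡sum : {A : Set} {R : Pred A _} (R? : Decidable R) (xs : Vec A m) →
            + count R? xs ≡ sum (λ i → ⟦ R? (lookup xs i) ⟧)
count≡sum R? []       = refl
count≡sum R? (x ∷ xs) with R? x
... | yes _ = cong (_+_ 1ℤ) (count≡sum R? xs)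
... | no  _ = trans (count≡sum R? xs) (sym (ℤ.+-identityˡ _))

-- Recursive sums over the subsets of a given size

-- Branching on the first element mirrors Pascal's rule, so counts follow by induction; an arbitrary
-- ordering of the subsets offers no such recursion.
sumₖ : (n k : ℕ) → (Subset n → ℤ) → ℤ
sumₖ n       zero    f = f ⊥
sumₖ zero    (suc k) f = 0ℤ
sumₖ (suc n) (suc k) f = sumₖ n k (f ∘ (inside ∷_)) + sumₖ n (suc k) (f ∘ (outside ∷_))

∣A∣≡0⇒A≡⊥ : (A : Subset n) → ∣ A ∣ ≡ 0 → A ≡ ⊥
∣A∣≡0⇒A≡⊥ []            _ = refl
∣A∣≡0⇒A≡⊥ (outside ∷ A) p = cong (outside ∷_) (∣A∣≡0⇒A≡⊥ A p)

-- The size restriction serves `sum≡sumₖ`: only subsets of size `k` have a position in the ordering.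
sumₖ-cong : ∀ n k {f g : Subset n → ℤ} → (∀ A → ∣ A ∣ ≡ k → f A ≡ g A) →
            sumₖ n k f ≡ sumₖ n k g
sumₖ-cong n       zero    f≗g = f≗g ⊥ (∣⊥∣≡0 n)
sumₖ-cong zero    (suc k) f≗g = refl
sumₖ-cong (suc n) (suc k) f≗g = cong₂ _+_
  (sumₖ-cong n k       (λ A p → f≗g (inside ∷ A) (cong suc p)))
  (sumₖ-cong n (suc k) (λ A p → f≗g (outside ∷ A) p))

sumₖ-zero : ∀ n k {f : Subset n → ℤ} → (∀ A → f A ≡ 0ℤ) → sumₖ n k f ≡ 0ℤ
sumₖ-zero n       zero    f≗0 = f≗0 ⊥
sumₖ-zero zero    (suc k) f≗0 = refl
sumₖ-zero (suc n) (suc k) f≗0 =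
  cong₂ _+_ (sumₖ-zero n k (f≗0 ∘ (inside ∷_))) (sumₖ-zero n (suc k) (f≗0 ∘ (outside ∷_)))

sumₖ-single : ∀ n k (f : Subset n → ℤ) (A : Subset n) → ∣ A ∣ ≡ k →
              (∀ X → X ≢ A → f X ≡ 0ℤ) → sumₖ n k f ≡ f A
sumₖ-single n       zero    f A             p off = cong f (sym (∣A∣≡0⇒A≡⊥ A p))
sumₖ-single (suc n) (suc k) f (inside ∷ A)  p off = trans
  (cong₂ _+_
    (sumₖ-single n k (f ∘ (inside ∷_)) A (ℕ.suc-injective p)
      λ X X≢A → off (inside ∷ X) (X≢A ∘ ∷-injectiveʳ))
    (sumₖ-zero n (suc k) λ X → off (outside ∷ X) λ ()))
  (ℤ.+-identityʳ _)
sumₖ-single (suc n) (suc k) f (outside ∷ A) p off = trans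
  (cong₂ _+_
    (sumₖ-zero n k λ X → off (inside ∷ X) λ ())
    (sumₖ-single n (suc k) (f ∘ (outside ∷_)) A p
      λ X X≢A → off (outside ∷ X) (X≢A ∘ ∷-injectiveʳ)))
  (ℤ.+-identityˡ _)

sum-sumₖ-comm : ∀ n k (f : Fin m → Subset n → ℤ) →
                sum (λ r → sumₖ n k (f r)) ≡ sumₖ n k (λ A → sum (λ r → f r A))
sum-sumₖ-comm n       zero    f = refl
sum-sumₖ-comm {m} zero (suc k) f = sum-replicate-zero m
sum-sumₖ-comm (suc n) (suc k) f = trans
  (∑-distrib-+ (λ r → sumₖ n k (f r ∘ (inside ∷_))) (λ r → sumₖ n (suc k) (f r ∘ (outside ∷_))))
  (cong₂ _+_ (sum-sumₖ-comm n k       (λ r → f r ∘ (inside ∷_)))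
             (sum-sumₖ-comm n (suc k) (λ r → f r ∘ (outside ∷_))))

-- Sums over an arbitrary ordering of the k-subsets

infix 4 _≟ˢ_

_≟ˢ_ : (A B : Subset n) → Dec (A ≡ B)
_≟ˢ_ = ≡-dec Bool._≟_

KSubset-≡ : {A B : KSubset n k} → proj₁ A ≡ proj₁ B → A ≡ B
KSubset-≡ {A = A , p} {B = .A , q} refl = cong (A ,_) (ℕ.≡-irrelevant p q)

module _ (order : Fin m ↔ KSubset n k) where
  open Inverse order

  subset : Fin m → Subset n
  subset r = proj₁ (to r)

  position : (A : Subset n) → ∣ A ∣ ≡ k → Fin m
  position A p = from (A , p)

  subset-position : (A : Subset n) (p : ∣ A ∣ ≡ k) → subset (position A p) ≡ A
  subset-position A p = cong proj₁ (strictlyInverseˡ (A , p))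

  position-unique : (A : Subset n) (p : ∣ A ∣ ≡ k) (r : Fin m) → subset r ≡ A →
                    r ≡ position A p
  position-unique A p r eq =
    trans (sym (strictlyInverseʳ r)) (cong from (KSubset-≡ eq))

  sum-single-subset : (A : Subset n) → ∣ A ∣ ≡ k → (f : Subset n → ℤ) →
                      (∀ X → X ≢ A → f X ≡ 0ℤ) → sum (f ∘ subset) ≡ f A
  sum-single-subset A p f off = trans
    (sum-single (f ∘ subset) (position A p)
      λ r r≢ → off (subset r) (r≢ ∘ position-unique A p r))
    (cong f (subset-position A p))

  -- Each summand is expanded against the indicator of `X ≡ subset r`, and the two sums are
  -- exchanged. Hence the result does not depend on `order`.
  sum≡sumₖ : (f : Subset n → ℤ) → sum (f ∘ subset) ≡ sumₖ n k f
  sum≡sumₖ f = begin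
    sum (f ∘ subset)
      ≡⟨ sum-cong-≗ (λ r → sym (trans
           (sumₖ-single n k (λ X → ⟦ X ≟ˢ subset r ⟧ · f X) (subset r) (proj₂ (to r))
              λ X X≢ → cong (_· f X) (⟦⟧-false (X ≟ˢ subset r) X≢))
           (trans (cong (_· f (subset r)) (⟦⟧-true (subset r ≟ˢ subset r) refl))
                  (ℤ.*-identityˡ _)))) ⟩
    sum (λ r → sumₖ n k (λ X → ⟦ X ≟ˢ subset r ⟧ · f X))
      ≡⟨ sum-sumₖ-comm n k (λ r X → ⟦ X ≟ˢ subset r ⟧ · f X) ⟩
    sumₖ n k (λ X → sum (λ r → ⟦ X ≟ˢ subset r ⟧ · f X))
      -- By `p`, the subset `X` has size `k`, so it is listed by `order` exactly once.
      ≡⟨ sumₖ-cong n k (λ X p → trans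
           (sum-single-subset X p (λ Y → ⟦ X ≟ˢ Y ⟧ · f X)
              λ Y Y≢X → cong (_· f X) (⟦⟧-false (X ≟ˢ Y) (Y≢X ∘ sym)))
           (trans (cong (_· f X) (⟦⟧-true (X ≟ˢ X) refl)) (ℤ.*-identityˡ _))) ⟩
    sumₖ n k f ∎

-- Counting k-subsets

pascal : ∀ n k → + (n C k) + + (n C suc k) ≡ + (suc n C suc k)
pascal n k = cong +_ (nCk+nC[k+1]≡[n+1]C[k+1] n k)

sumₖ-1 : ∀ n k → sumₖ n k (λ _ → 1ℤ) ≡ + (n C k)
sumₖ-1 n       zero    = refl
sumₖ-1 zero    (suc k) = refl
sumₖ-1 (suc n) (suc k) = trans (cong₂ _+_ (sumₖ-1 n k) (sumₖ-1 n (suc k))) (pascal n k)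

∈⊥-zero : (i : Fin n) → ⟦ i ∈? ⊥ ⟧ ≡ 0ℤ
∈⊥-zero i = ⟦⟧-false (i ∈? ⊥) ∉⊥

sumₖ-∈ : ∀ n k (i : Fin (suc n)) → sumₖ (suc n) (suc k) (λ A → ⟦ i ∈? A ⟧) ≡ + (n C k)
sumₖ-∈ n k zero = trans (cong₂ _+_ (sumₖ-1 n k) (sumₖ-zero n (suc k) λ _ → refl))
                        (ℤ.+-identityʳ _)
sumₖ-∈ (suc n) zero    (suc i) = cong₂ _+_ (∈⊥-zero i) (sumₖ-∈ n zero i)
sumₖ-∈ (suc n) (suc k) (suc i) =
  trans (cong₂ _+_ (sumₖ-∈ n k i) (sumₖ-∈ n (suc k) i)) (pascal n k)

sumₖ-∉ : ∀ n k (i : Fin (suc n)) → sumₖ (suc n) k (λ A → 1ℤ - ⟦ i ∈? A ⟧) ≡ + (n C k)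
sumₖ-∉ n       zero    i    = cong (_-_ 1ℤ) (∈⊥-zero i)
sumₖ-∉ n       (suc k) zero = trans
  (cong₂ _+_ (sumₖ-zero n k λ _ → refl) (sumₖ-1 n (suc k))) (ℤ.+-identityˡ _)
sumₖ-∉ (suc n) (suc k) (suc i) =
  trans (cong₂ _+_ (sumₖ-∉ n k i) (sumₖ-∉ n (suc k) i)) (pascal n k)

-- With `i` forced in and `j` forced out, `k` elements remain to be chosen among `n` others. If the
-- first element is `i` or `j`, one condition is left; otherwise Pascal's rule adds the two
-- branches.
sumₖ-separating : ∀ n k (i j : Fin (suc (suc n))) → i ≢ j →
  sumₖ (suc (suc n)) (suc k) (λ A → ⟦ i ∈? A ⟧ · (1ℤ - ⟦ j ∈? A ⟧)) ≡ + (n C k)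
sumₖ-separating n k zero zero i≢j = contradiction refl i≢j
sumₖ-separating n k zero (suc j) i≢j = trans
  (cong₂ _+_
    (trans (sumₖ-cong (suc n) k λ A _ → ℤ.*-identityˡ _) (sumₖ-∉ n k j))
    (sumₖ-zero (suc n) (suc k) λ _ → refl))
  (ℤ.+-identityʳ _)
sumₖ-separating n k (suc i) zero i≢j = trans
  (cong₂ _+_
    (sumₖ-zero (suc n) k λ A → ℤ.*-zeroʳ ⟦ i ∈? A ⟧)
    (trans (sumₖ-cong (suc n) (suc k) λ A _ → ℤ.*-identityʳ ⟦ i ∈? A ⟧) (sumₖ-∈ n k i)))
  (ℤ.+-identityˡ _)
sumₖ-separating zero k (suc zero) (suc zero) i≢j = contradiction refl i≢j
-- For one-element subsets, the branch that takes the first element is left with `⊥`, which misses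
-- `i` and contributes nothing.
sumₖ-separating (suc n) zero (suc i) (suc j) i≢j = cong₂ _+_
  (cong (_· (1ℤ - ⟦ j ∈? ⊥ ⟧)) (∈⊥-zero i))
  (sumₖ-separating n zero i j (i≢j ∘ cong suc))
sumₖ-separating (suc n) (suc k) (suc i) (suc j) i≢j = trans
  (cong₂ _+_ (sumₖ-separating n k i j (i≢j ∘ cong suc))
             (sumₖ-separating n (suc k) i j (i≢j ∘ cong suc)))
  (pascal n k)

-- Laplacians

module _ {V : Set} (G : Graph V) (order : Fin m ↔ V) where
  open Graph G
  open Inverse order using () renaming (to to vertex)

  private
    L = laplacian G order
    A = adjacencyMatrix G order
    D = degreeMatrix G order

  degree≡sum : ∀ r → + degree G order (vertex r) ≡ sum (A r)
  degree≡sum r = trans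
    (count≡sum (λ s → adj? (vertex r) (vertex s)) (allFin m))
    (sum-cong-≗ λ s →
      cong (λ t → ⟦ adj? (vertex r) (vertex t) ⟧) (lookup-allFin s))

  -- The diagonal entry is the row sum of `A`, so the degree term becomes a sum over neighbours and
  -- combines termwise with the adjacency term.
  degreeMatrix-action : ∀ r (x : Fin m → ℤ) → sum (λ s → D r s · x s) ≡ sum (λ s → A r s · x r)
  degreeMatrix-action r x = begin
    sum (λ s → D r s · x s)  ≡⟨ sum-single _ r (λ s s≢r → cong (_· x s) (off s (s≢r ∘ sym))) ⟩
    D r r · x r              ≡⟨ cong (_· x r) diagonal ⟩
    sum (A r) · x r          ≡⟨ *-distribʳ-sum (x r) (A r) ⟩
    sum (λ s → A r s · x r)  ∎
    where
    off : ∀ s → r ≢ s → D r s ≡ 0ℤ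
    off s r≢s = cong (if_then + degree G order (vertex r) else 0ℤ) (dec-false (r ≟ᶠ s) r≢s)

    diagonal : D r r ≡ sum (A r)
    diagonal = trans
      (cong (if_then + degree G order (vertex r) else 0ℤ) (dec-true (r ≟ᶠ r) refl))
      (degree≡sum r)

  -- Stated for any vertex type: it serves both the token graph with its ordering and `G` with the
  -- identity ordering.
  laplacian-action : ∀ r (x : Fin m → ℤ) →
    sum (λ s → L r s · x s) ≡ sum (λ s → ⟦ adj? (vertex r) (vertex s) ⟧ · (x r - x s))
  laplacian-action r x = begin
    sum (λ s → L r s · x s)
      ≡⟨ sum-cong-≗ (λ s → distribʳ (D r s) (A r s) (x s)) ⟩
    sum (λ s → D r s · x s - A r s · x s)
      ≡⟨ sum-distrib-- _ (λ s → A r s · x s) ⟩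
    sum (λ s → D r s · x s) - sum (λ s → A r s · x s)
      ≡⟨ cong (_- sum (λ s → A r s · x s)) (degreeMatrix-action r x) ⟩
    sum (λ s → A r s · x r) - sum (λ s → A r s · x s)
      ≡⟨ sum-distrib-- (λ s → A r s · x r) (λ s → A r s · x s) ⟨
    sum (λ s → A r s · x r - A r s · x s)
      ≡⟨ sum-cong-≗ (λ s → sym (distribˡ (A r s) (x r) (x s))) ⟩
    sum (λ s → A r s · (x r - x s)) ∎
    where
    distribʳ : ∀ a b c → (a - b) · c ≡ a · c - b · c
    distribʳ = solve-∀

    distribˡ : ∀ a b c → a · (b - c) ≡ a · b - a · c
    distribˡ = solve-∀

  -- The final computation ends at the entry `(l, i)`, whereas the claim concerns `(i, l)`.
  laplacian-sym : ∀ r s → L r s ≡ L s r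
  laplacian-sym r s = cong₂ _-_ (degreeMatrix-sym r s)
    (⟦⟧-cong (mk⇔ symm symm) (adj? (vertex r) (vertex s)) (adj? (vertex s) (vertex r)))
    where
    degreeMatrix-sym : ∀ r s → D r s ≡ D s r
    degreeMatrix-sym r s with r ≟ᶠ s
    ... | yes refl = sym (cong (if_then + degree G order (vertex r) else 0ℤ) (dec-true (r ≟ᶠ r) refl))
    ... | no r≢s   = sym (cong (if_then + degree G order (vertex s) else 0ℤ)
                               (dec-false (s ≟ᶠ r) (r≢s ∘ sym)))

-- Symmetric differences

△-identityʳ : (A : Subset n) → A △ ⊥ ≡ A
△-identityʳ = zipWith-identityʳ Bool.xor-identityʳ

-- Makes `A △ C` the only solution `X` of `A △ X ≡ C`: the edge used determines where a token move
-- leads.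
△-cancelˡ : (A B : Subset n) → A △ (A △ B) ≡ B
△-cancelˡ []            []      = refl
△-cancelˡ (inside ∷ A)  (b ∷ B) = cong₂ _∷_ (Bool.not-involutive b) (△-cancelˡ A B)
△-cancelˡ (outside ∷ A) (b ∷ B) = cong (b ∷_) (△-cancelˡ A B)

∈△⁺ˡ : {x : Fin n} (A B : Subset n) → x ∈ A → x ∉ B → x ∈ A △ B
∈△⁺ˡ (_ ∷ A) (inside ∷ B)  here      x∉B = contradiction here x∉B
∈△⁺ˡ (_ ∷ A) (outside ∷ B) here      x∉B = here
∈△⁺ˡ (_ ∷ A) (_ ∷ B)       (there p) x∉B = there (∈△⁺ˡ A B p (x∉B ∘ there))

∈△⁺ʳ : {x : Fin n} (A B : Subset n) → x ∉ A → x ∈ B → x ∈ A △ B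
∈△⁺ʳ (inside ∷ A)  (_ ∷ B) x∉A here      = contradiction here x∉A
∈△⁺ʳ (outside ∷ A) (_ ∷ B) x∉A here      = here
∈△⁺ʳ (_ ∷ A)       (_ ∷ B) x∉A (there p) = there (∈△⁺ʳ A B (x∉A ∘ there) p)

∈△⇒∉∩ : {x : Fin n} (A B : Subset n) → x ∈ A △ B → x ∈ A → x ∉ B
∈△⇒∉∩ (_ ∷ A) (_ ∷ B) () here here
∈△⇒∉∩ (_ ∷ A) (_ ∷ B) (there p) (there q) (there r) = ∈△⇒∉∩ A B p q r

∈△∧∉⇒∈ʳ : {x : Fin n} (A B : Subset n) → x ∈ A △ B → x ∉ A → x ∈ B
∈△∧∉⇒∈ʳ {x = zero}  (inside ∷ A)  (_ ∷ B)       _         x∉A = contradiction here x∉A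
∈△∧∉⇒∈ʳ {x = zero}  (outside ∷ A) (inside ∷ B)  _         x∉A = here
∈△∧∉⇒∈ʳ {x = suc x} (_ ∷ A)       (_ ∷ B)       (there p) x∉A = there (∈△∧∉⇒∈ʳ A B p (x∉A ∘ there))

∉△⇒⇔ : {x : Fin n} (A B : Subset n) → x ∉ A △ B → x ∈ A ⇔ x ∈ B
∉△⇒⇔ {x = x} A B x∉ = mk⇔
  (λ x∈A → decidable-stable (x ∈? B) λ x∉B → x∉ (∈△⁺ˡ A B x∈A x∉B))
  (λ x∈B → decidable-stable (x ∈? A) λ x∉A → x∉ (∈△⁺ʳ A B x∉A x∈B))

∣A△⁅j⁆∣-∉ : (A : Subset n) (j : Fin n) → j ∉ A → ∣ A △ ⁅ j ⁆ ∣ ≡ suc ∣ A ∣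
∣A△⁅j⁆∣-∉ (inside ∷ A)  zero    j∉A = contradiction here j∉A
∣A△⁅j⁆∣-∉ (outside ∷ A) zero    j∉A = cong (suc ∘ ∣_∣) (△-identityʳ A)
∣A△⁅j⁆∣-∉ (inside ∷ A)  (suc j) j∉A = cong suc (∣A△⁅j⁆∣-∉ A j (j∉A ∘ there))
∣A△⁅j⁆∣-∉ (outside ∷ A) (suc j) j∉A = ∣A△⁅j⁆∣-∉ A j (j∉A ∘ there)

∣A△⁅i⁆∣-∈ : (A : Subset n) {i : Fin n} → i ∈ A → suc ∣ A △ ⁅ i ⁆ ∣ ≡ ∣ A ∣
∣A△⁅i⁆∣-∈ (inside ∷ A)  here      = cong (suc ∘ ∣_∣) (△-identityʳ A)
∣A△⁅i⁆∣-∈ (inside ∷ A)  (there p) = cong suc (∣A△⁅i⁆∣-∈ A p)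
∣A△⁅i⁆∣-∈ (outside ∷ A) (there p) = ∣A△⁅i⁆∣-∈ A p

-- Induction until `i` or `j` reaches the head; toggling the other singleton in the tail then
-- compensates for the change at the head.
∣move∣ : (A : Subset n) {i : Fin n} (j : Fin n) → i ∈ A → j ∉ A →
         ∣ A △ (⁅ i ⁆ ∪ ⁅ j ⁆) ∣ ≡ ∣ A ∣
∣move∣ (inside ∷ A)  zero    p    j∉A = contradiction here j∉A
∣move∣ (inside ∷ A)  (suc j) here j∉A =
  trans (cong (∣_∣ ∘ (A △_)) (∪-identityˡ ⁅ j ⁆)) (∣A△⁅j⁆∣-∉ A j (j∉A ∘ there))
∣move∣ (outside ∷ A) {suc i} zero (there p) j∉A =
  trans (cong (suc ∘ ∣_∣ ∘ (A △_)) (∪-identityʳ ⁅ i ⁆)) (∣A△⁅i⁆∣-∈ A p)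
∣move∣ (inside ∷ A)  (suc j) (there p) j∉A = cong suc (∣move∣ A j p (j∉A ∘ there))
∣move∣ (outside ∷ A) (suc j) (there p) j∉A = ∣move∣ A j p (j∉A ∘ there)

-- Token graphs

-- Lets `sum-moveTerm` argue from adjacency or its negation, without unfolding the search for an
-- edge inside the decision.
⟦⟧-· : (P? : Dec P) {x y : ℤ} → (P → x ≡ y) → (¬ P → x ≡ 0ℤ) → x ≡ ⟦ P? ⟧ · y
⟦⟧-· (yes p) p⇒ ¬p⇒ = trans (p⇒ p) (sym (ℤ.*-identityˡ _))
⟦⟧-· (no ¬p) p⇒ ¬p⇒ = ¬p⇒ ¬p

module _ (G : Graph (Fin n)) (order : Fin m ↔ KSubset n k) where
  open Graph G

  private
    T = tokenGraph G k
    module T = Graph T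

  -- Summed over B, this collects the effect of moving one token of A along the
  -- edge jb; summed over b, it is nonzero only when B is a neighbour of A and j
  -- is one of the two ends of the edge used.
  moveTerm : (A B : Subset n) (j b : Fin n) → ℤ
  moveTerm A B j b =
    ⟦ A △ B ≟ˢ ⁅ j ⁆ ∪ ⁅ b ⁆ ⟧ · (⟦ adj? j b ⟧ · (⟦ j ∈? A ⟧ - ⟦ b ∈? A ⟧))

  moveTerm-≢ : ∀ A B j b → A △ B ≢ ⁅ j ⁆ ∪ ⁅ b ⁆ → moveTerm A B j b ≡ 0ℤ
  moveTerm-≢ A B j b ≢ = cong (_· (⟦ adj? j b ⟧ · (⟦ j ∈? A ⟧ - ⟦ b ∈? A ⟧)))
                              (⟦⟧-false (A △ B ≟ˢ ⁅ j ⁆ ∪ ⁅ b ⁆) ≢)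

  -- Only one term survives: `A △ B` fixes the second end, since `b` equal to `j` would give a loop.
  -- A move along an edge swaps the memberships of its ends, which is the last hypothesis.
  sum-moveTerm-single : ∀ A B j b → A △ B ≡ ⁅ j ⁆ ∪ ⁅ b ⁆ → Adj j b →
    ⟦ b ∈? A ⟧ ≡ ⟦ j ∈? B ⟧ →
    sum (moveTerm A B j) ≡ ⟦ j ∈? A ⟧ - ⟦ j ∈? B ⟧
  sum-moveTerm-single A B j b eq jb b∈A≡j∈B = begin
    sum (moveTerm A B j)
      ≡⟨ sum-single (moveTerm A B j) b (λ c c≢b → moveTerm-≢ A B j c (c≢b ∘ unique c)) ⟩
    moveTerm A B j b
      ≡⟨ cong₂ _·_ (⟦⟧-true (A △ B ≟ˢ ⁅ j ⁆ ∪ ⁅ b ⁆) eq)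
           (cong₂ _·_ (⟦⟧-true (adj? j b) jb) (cong (_-_ ⟦ j ∈? A ⟧) b∈A≡j∈B)) ⟩
    1ℤ · (1ℤ · (⟦ j ∈? A ⟧ - ⟦ j ∈? B ⟧))
      ≡⟨ trans (ℤ.*-identityˡ _) (ℤ.*-identityˡ _) ⟩
    ⟦ j ∈? A ⟧ - ⟦ j ∈? B ⟧ ∎
    where
    unique : ∀ c → A △ B ≡ ⁅ j ⁆ ∪ ⁅ c ⁆ → c ≡ b
    unique c eq′ with x∈p∪q⁻ ⁅ j ⁆ ⁅ c ⁆
      (subst (b ∈_) (trans (sym eq) eq′) (x∈p∪q⁺ (inj₂ (x∈⁅x⁆ b))))
    ... | inj₁ b∈⁅j⁆ = contradiction (subst (Adj j) (x∈⁅y⁆⇒x≡y j b∈⁅j⁆) jb) (irrefl refl)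
    ... | inj₂ b∈⁅c⁆ = sym (x∈⁅y⁆⇒x≡y c b∈⁅c⁆)

  -- If `j` is an end of the edge used, the previous lemma applies with the other end as `b`. If
  -- not, no term matches and `j` keeps its membership, so both sides vanish.
  sum-moveTerm-adj : ∀ X Y j → T.Adj X Y →
    sum (moveTerm (proj₁ X) (proj₁ Y) j) ≡ ⟦ j ∈? proj₁ X ⟧ - ⟦ j ∈? proj₁ Y ⟧
  sum-moveTerm-adj (A , _) (B , _) j (a , c , eq , a∈A , c∈B , ac)
    with j ≟ᶠ a | j ≟ᶠ c
  ... | yes refl | _ = sum-moveTerm-single A B a c eq ac
    (trans (⟦⟧-false (c ∈? A) c∉A) (sym (⟦⟧-false (a ∈? B) a∉B)))
    where
    a∉B : a ∉ B
    a∉B = ∈△⇒∉∩ A B (subst (a ∈_) (sym eq) (x∈p∪q⁺ (inj₁ (x∈⁅x⁆ a)))) a∈A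

    c∉A : c ∉ A
    c∉A c∈A = ∈△⇒∉∩ A B (subst (c ∈_) (sym eq) (x∈p∪q⁺ (inj₂ (x∈⁅x⁆ c)))) c∈A c∈B
  -- Here `j` receives the token, so the edge is read from its other end.
  ... | no _     | yes refl = sum-moveTerm-single A B c a
    (trans eq (∪-comm ⁅ a ⁆ ⁅ c ⁆)) (symm ac)
    (trans (⟦⟧-true (a ∈? A) a∈A) (sym (⟦⟧-true (c ∈? B) c∈B)))
  ... | no j≢a   | no j≢c = trans
    (sum-zero λ b → moveTerm-≢ A B j b λ eq′ →
      j∉A△B (subst (j ∈_) (sym eq′) (x∈p∪q⁺ (inj₁ (x∈⁅x⁆ j)))))
    (sym (ℤ.i≡j⇒i-j≡0
      (⟦⟧-cong (∉△⇒⇔ A B j∉A△B) (j ∈? A) (j ∈? B))))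
    where
    j∉A△B : j ∉ A △ B
    j∉A△B j∈ with x∈p∪q⁻ ⁅ a ⁆ ⁅ c ⁆ (subst (j ∈_) eq j∈)
    ... | inj₁ j∈⁅a⁆ = j≢a (x∈⁅y⁆⇒x≡y a j∈⁅a⁆)
    ... | inj₂ j∈⁅c⁆ = j≢c (x∈⁅y⁆⇒x≡y c j∈⁅c⁆)

  -- A nonzero term needs `A △ B` to be an edge `jb` with exactly one end in `A`. The other end then
  -- lies in `B`, which makes the two subsets adjacent.
  moveTerm-¬adj : ∀ X Y j → ¬ T.Adj X Y → ∀ b → moveTerm (proj₁ X) (proj₁ Y) j b ≡ 0ℤ
  moveTerm-¬adj (A , _) (B , _) j ¬XY b with A △ B ≟ˢ ⁅ j ⁆ ∪ ⁅ b ⁆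
  ... | no  _  = refl
  ... | yes eq with adj? j b
  ...   | no  _  = refl
  ...   | yes jb with j ∈? A | b ∈? A
  ...     | yes _   | yes _   = refl
  ...     | no  _   | no  _   = refl
  ...     | yes j∈A | no  b∉A = contradiction
    (j , b , eq , j∈A , b∈B , jb) ¬XY
    where
    b∈B : b ∈ B
    b∈B = ∈△∧∉⇒∈ʳ A B (subst (b ∈_) (sym eq) (x∈p∪q⁺ (inj₂ (x∈⁅x⁆ b)))) b∉A
  ...     | no  j∉A | yes b∈A = contradiction
    (b , j , trans eq (∪-comm ⁅ j ⁆ ⁅ b ⁆) , b∈A , j∈B , symm jb) ¬XY
    where
    j∈B : j ∈ B
    j∈B = ∈△∧∉⇒∈ʳ A B (subst (j ∈_) (sym eq) (x∈p∪q⁺ (inj₁ (x∈⁅x⁆ j)))) j∉A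

  sum-moveTerm : ∀ X Y j →
    sum (moveTerm (proj₁ X) (proj₁ Y) j) ≡
    ⟦ T.adj? X Y ⟧ · (⟦ j ∈? proj₁ X ⟧ - ⟦ j ∈? proj₁ Y ⟧)
  sum-moveTerm X Y j = ⟦⟧-· (T.adj? X Y) (sum-moveTerm-adj X Y j)
    (λ ¬XY → sum-zero (moveTerm-¬adj X Y j ¬XY))

  -- The unique solution `A △ C` has size `k`, so it occurs once in the ordering.
  sum-△-single : (A C : Subset n) → ∣ A △ C ∣ ≡ k → (x : ℤ) →
                 sum (λ s → ⟦ A △ subset order s ≟ˢ C ⟧ · x) ≡ x
  sum-△-single A C p x = begin
    sum (λ s → ⟦ A △ subset order s ≟ˢ C ⟧ · x)
      ≡⟨ sum-single-subset order (A △ C) p (λ X → ⟦ A △ X ≟ˢ C ⟧ · x)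
           (λ X X≢ → cong (_· x) (⟦⟧-false (A △ X ≟ˢ C)
             λ eq → X≢ (trans (sym (△-cancelˡ A X)) (cong (A △_) eq)))) ⟩
    ⟦ A △ (A △ C) ≟ˢ C ⟧ · x
      ≡⟨ cong (_· x) (⟦⟧-true (A △ (A △ C) ≟ˢ C) (△-cancelˡ A C)) ⟩
    1ℤ · x
      ≡⟨ ℤ.*-identityˡ x ⟩
    x ∎

  -- If exactly one of `j` and `b` lies in `A`, swapping them preserves the size and one subset
  -- contributes; otherwise the difference is zero.
  sum-moveTerm-subsets : ∀ A j b → ∣ A ∣ ≡ k →
    sum (λ s → moveTerm A (subset order s) j b) ≡
    ⟦ adj? j b ⟧ · (⟦ j ∈? A ⟧ - ⟦ b ∈? A ⟧)
  sum-moveTerm-subsets A j b p with j ∈? A | b ∈? A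
  ... | yes _   | yes _   = sum-·0 (λ s → ⟦ A △ subset order s ≟ˢ ⁅ j ⁆ ∪ ⁅ b ⁆ ⟧) ⟦ adj? j b ⟧
  ... | no  _   | no  _   = sum-·0 (λ s → ⟦ A △ subset order s ≟ˢ ⁅ j ⁆ ∪ ⁅ b ⁆ ⟧) ⟦ adj? j b ⟧
  ... | yes j∈A | no  b∉A = sum-△-single A (⁅ j ⁆ ∪ ⁅ b ⁆) (trans (∣move∣ A b j∈A b∉A) p) _
  ... | no  j∉A | yes b∈A = sum-△-single A (⁅ j ⁆ ∪ ⁅ b ⁆)
    (trans (cong (∣_∣ ∘ (A △_)) (∪-comm ⁅ j ⁆ ⁅ b ⁆)) (trans (∣move∣ A j b∈A j∉A) p)) _

  -- The entrywise form of the intertwining identity Lₖ B = B L₁, with the symmetric L₁ already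
  -- expanded as a sum over neighbours of `j`.
  laplacian-token-action : ∀ r j →
    sum (λ s → laplacian T order r s · ⟦ j ∈? subset order s ⟧) ≡
    sum (λ b → ⟦ adj? j b ⟧ · (⟦ j ∈? subset order r ⟧ - ⟦ b ∈? subset order r ⟧))
  laplacian-token-action r j = begin
    sum (λ s → laplacian T order r s · ⟦ j ∈? subset order s ⟧)
      ≡⟨ laplacian-action T order r (λ s → ⟦ j ∈? subset order s ⟧) ⟩
    sum (λ s → ⟦ T.adj? (to r) (to s) ⟧ · (⟦ j ∈? A ⟧ - ⟦ j ∈? subset order s ⟧))
      ≡⟨ sum-cong-≗ (λ s → sum-moveTerm (to r) (to s) j) ⟨
    sum (λ s → sum (moveTerm A (subset order s) j))
      -- The exchange trades neighbours of `A` in the token graph for neighbours of `j` in `G`.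
      ≡⟨ ∑-comm (λ s → moveTerm A (subset order s) j) ⟩
    sum (λ b → sum (λ s → moveTerm A (subset order s) j b))
      ≡⟨ sum-cong-≗ (λ b → sum-moveTerm-subsets A j b (proj₂ (to r))) ⟩
    sum (λ b → ⟦ adj? j b ⟧ · (⟦ j ∈? A ⟧ - ⟦ b ∈? A ⟧)) ∎
    where
    open Inverse order using (to)
    A = subset order r

-- Inner products of columns of the binomial matrix

module _ (order : Fin m ↔ KSubset (suc (suc n)) (suc k)) where

  -- No subset both contains and misses `i`; the factor `1ℤ - ⟦ i ≟ᶠ j ⟧` encodes this case together
  -- with the count for distinct elements.
  sum-separating : (i j : Fin (suc (suc n))) →
    sum (λ r → ⟦ i ∈? subset order r ⟧ · (1ℤ - ⟦ j ∈? subset order r ⟧)) ≡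
    + (n C k) · (1ℤ - ⟦ i ≟ᶠ j ⟧)
  sum-separating i j with i ≟ᶠ j
  ... | yes refl = trans (sum-zero (λ r → complement (i ∈? subset order r)))
                         (sym (ℤ.*-zeroʳ (+ (n C k))))
    where
    complement : (P? : Dec P) → ⟦ P? ⟧ · (1ℤ - ⟦ P? ⟧) ≡ 0ℤ
    complement (yes _) = refl
    complement (no  _) = refl
  ... | no i≢j = trans (sum≡sumₖ order (λ A → ⟦ i ∈? A ⟧ · (1ℤ - ⟦ j ∈? A ⟧)))
                       (trans (sumₖ-separating n k i j i≢j) (sym (ℤ.*-identityʳ _)))

  -- Writing y - z as (1 - z) - (1 - y) leaves two separating counts, so subsets containing two
  -- given elements need not be counted.
  sum-∈-difference : (i l b : Fin (suc (suc n))) →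
    sum (λ r → ⟦ i ∈? subset order r ⟧ · (⟦ l ∈? subset order r ⟧ - ⟦ b ∈? subset order r ⟧)) ≡
    + (n C k) · (⟦ i ≟ᶠ l ⟧ - ⟦ i ≟ᶠ b ⟧)
  sum-∈-difference i l b = begin
    sum (λ r → B r i · (B r l - B r b))
      ≡⟨ sum-cong-≗ (λ r → as-complements (B r i) (B r l) (B r b)) ⟩
    sum (λ r → B r i · (1ℤ - B r b) - B r i · (1ℤ - B r l))
      ≡⟨ sum-distrib-- (λ r → B r i · (1ℤ - B r b)) (λ r → B r i · (1ℤ - B r l)) ⟩
    sum (λ r → B r i · (1ℤ - B r b)) - sum (λ r → B r i · (1ℤ - B r l))
      ≡⟨ cong₂ _-_ (sum-separating i b) (sum-separating i l) ⟩
    c · (1ℤ - ⟦ i ≟ᶠ b ⟧) - c · (1ℤ - ⟦ i ≟ᶠ l ⟧)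
      ≡⟨ as-complements c ⟦ i ≟ᶠ l ⟧ ⟦ i ≟ᶠ b ⟧ ⟨
    c · (⟦ i ≟ᶠ l ⟧ - ⟦ i ≟ᶠ b ⟧) ∎
    where
    c = + (n C k)
    B : Fin m → Fin (suc (suc n)) → ℤ
    B r i = ⟦ i ∈? subset order r ⟧

    as-complements : ∀ x y z → x · (y - z) ≡ x · (1ℤ - z) - x · (1ℤ - y)
    as-complements = solve-∀

-- The matrix identity

*ᴹ-assoc : ∀ {p q r s} (M : Matrix p q) (N : Matrix q r) (O : Matrix r s) →
           M *ᴹ N *ᴹ O ≈ᴹ M *ᴹ (N *ᴹ O)
*ᴹ-assoc M N O i j = begin
  sum (λ s → sum (λ r → M i r · N r s) · O s j)
    ≡⟨ sum-cong-≗ (λ s → *-distribʳ-sum (O s j) (λ r → M i r · N r s)) ⟩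
  sum (λ s → sum (λ r → M i r · N r s · O s j))
    ≡⟨ ∑-comm (λ s r → M i r · N r s · O s j) ⟩
  sum (λ r → sum (λ s → M i r · N r s · O s j))
    ≡⟨ sum-cong-≗ (λ r → sum-cong-≗ (λ s → ℤ.*-assoc (M i r) (N r s) (O s j))) ⟩
  sum (λ r → sum (λ s → M i r · (N r s · O s j)))
    ≡⟨ sum-cong-≗ (λ r → *-distribˡ-sum (M i r) (λ s → N r s · O s j)) ⟨
  sum (λ r → M i r · sum (λ s → N r s · O s j)) ∎

theorem3p3 : (n : ℕ) (G : Graph (Fin n)) (k : ℕ) → 1 ≤ k → 2 * k ≤ n →
    (order : Fin (n C k) ↔ KSubset n k) →
    let L₁ = laplacian G (↔-id (Fin n))
        Lₖ = laplacian (tokenGraph G k) order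
        B  = binomialMatrix n k order
    in  B ᵀ *ᴹ Lₖ *ᴹ B ≈ᴹ (+ ((n ∸ 2) C (k ∸ 1))) ·ᴹ L₁
-- A single vertex contradicts 2 ≤ 2k ≤ n. Afterwards n ≥ 2 and k ≥ 1, so both truncated
-- subtractions compute.
theorem3p3 (suc zero) G (suc k) 1≤k (s≤s 2k≤n) order =
  contradiction (ℕ.m+n≤o⇒n≤o k 2k≤n) λ ()
theorem3p3 (suc (suc n)) G (suc k) 1≤k 2k≤n order i l = begin
  (B ᵀ *ᴹ Lₖ *ᴹ B) i l
    -- The product associates to the left; regrouping exposes Lₖ B.
    ≡⟨ *ᴹ-assoc (B ᵀ) Lₖ B i l ⟩
  sum (λ r → B r i · sum (λ s → Lₖ r s · B s l))
    ≡⟨ sum-cong-≗ (λ r → cong (B r i ·_) (laplacian-token-action G order r l)) ⟩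
  sum (λ r → B r i · sum (λ b → a b · (B r l - B r b)))
    ≡⟨ sum-cong-≗ (λ r → *-distribˡ-sum (B r i) (λ b → a b · (B r l - B r b))) ⟩
  sum (λ r → sum (λ b → B r i · (a b · (B r l - B r b))))
    -- For each fixed `b`, the sum over subsets becomes a count.
    ≡⟨ ∑-comm (λ r b → B r i · (a b · (B r l - B r b))) ⟩
  sum (λ b → sum (λ r → B r i · (a b · (B r l - B r b))))
    ≡⟨ sum-cong-≗ (λ b → sum-cong-≗ (λ r → x∙yz≈y∙xz (B r i) (a b) (B r l - B r b))) ⟩
  sum (λ b → sum (λ r → a b · (B r i · (B r l - B r b))))
    ≡⟨ sum-cong-≗ (λ b → *-distribˡ-sum (a b) (λ r → B r i · (B r l - B r b))) ⟨
  sum (λ b → a b · sum (λ r → B r i · (B r l - B r b)))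
    ≡⟨ sum-cong-≗ (λ b → cong (a b ·_) (sum-∈-difference order i l b)) ⟩
  sum (λ b → a b · (c · (δ l - δ b)))
    ≡⟨ sum-cong-≗ (λ b → x∙yz≈y∙xz (a b) c (δ l - δ b)) ⟩
  sum (λ b → c · (a b · (δ l - δ b)))
    ≡⟨ *-distribˡ-sum c (λ b → a b · (δ l - δ b)) ⟨
  c · sum (λ b → a b · (δ l - δ b))
    -- The sum over neighbours of `l` is read back as row `l` of `L₁` applied to the unit vector at
    -- `i`.
    ≡⟨ cong (c ·_) (laplacian-action G (↔-id _) l δ) ⟨
  c · sum (λ b → L₁ l b · δ b)
    ≡⟨ cong (c ·_) (sum-single (λ b → L₁ l b · δ b) i λ b b≢i →
         trans (cong (L₁ l b ·_) (⟦⟧-false (i ≟ᶠ b) (b≢i ∘ sym))) (ℤ.*-zeroʳ (L₁ l b))) ⟩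
  c · (L₁ l i · δ i)
    ≡⟨ cong (c ·_) (trans (cong (L₁ l i ·_) (⟦⟧-true (i ≟ᶠ i) refl)) (ℤ.*-identityʳ (L₁ l i))) ⟩
  c · L₁ l i
    ≡⟨ cong (c ·_) (laplacian-sym G (↔-id _) l i) ⟩
  c · L₁ i l ∎
  where
  L₁ = laplacian G (↔-id (Fin (suc (suc n))))
  Lₖ = laplacian (tokenGraph G (suc k)) order
  B  = binomialMatrix (suc (suc n)) (suc k) order
  c  = + (n C k)

  a δ : Fin (suc (suc n)) → ℤ
  a b = ⟦ Graph.adj? G l b ⟧
  δ b = ⟦ i ≟ᶠ b ⟧
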